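{- Let $m\ge 1$ and let $M$ be a color complete $m$-pole. Then the number $\sigma(m)$ of states of $M$ (counted up to permutation of the three colors) is $$\sigma(m)=\frac{1}{8}\left[3^{m-1}+2+(-1)^m\,3\right].$$
   Context: An $m$-pole ($m\ge 1$), or multipole, $M=(V,E,\mathcal{E})$ consists of a finite set $V$ of vertices, a finite collection $E$ of edges (unordered pairs of vertices; parallel edges and loops may occur), and a set $\mathcal{E}=\{\epsilon_1,\dots,\epsilon_m\}$ of $m$ semiedges. Each semiedge is either incident to exactly one vertex, or is paired with another semiedge to form a free (isolated) edge, which has no vertices. All multipoles are cubic: for each vertex, the number of edges (loops counted twice) plus semiedges incident to it is $3$. A multipole may be disconnected, and $V$ may be empty. A Tait coloring of $M$ is a map $\phi:E\cup\mathcal{E}\to\{1,2,3\}$ such that the three edges/semiedges incident with any vertex receive distinct colors (so a multipole with a loop has none) and the two semiedges of any free edge receive the same color. A state of $M$ is a tuple $(\phi(\epsilon_1),\dots,\phi(\epsilon_m))$ with $\phi$ a Tait coloring of $M$. Two states are equivalent if one is obtained from the other by a permutation of the colors; the number of states of $M$ means the number of equivalence classes of states. A tuple in $\{1,2,3\}^m$ is admissible if, with $m_i$ the number of entries equal to $i$, $m_1\equiv m_2\equiv m_3\equiv m\pmod 2$. (By the Parity Lemma every state is admissible.) $M$ is color complete if every admissible tuple is a state of $M$. -}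

module Defs where

open import Data.Fin.Base using (Fin)
open import Data.Fin.Permutation as Perm using (Permutation′; _⟨$⟩ʳ_; _∘ₚ_; flip; inverseˡ)
open import Data.Fin.Properties using (_≟_; cantor-schröder-bernstein)
open import Data.Nat.Base using (ℕ; _+_; _%_)
open import Data.Product.Base using (Σ; ∃; _×_; _,_; proj₁; proj₂)
open import Data.Sum.Base using (_⊎_; inj₁; inj₂)
open import Data.Sum.Properties using (≡-dec)
open import Data.Vec.Base using (Vec; allFin; count; map; tabulate)
open import Data.Vec.Properties using (map-∘; map-cong; map-id)
open import Function.Base using (_∘_)
open import Function.Bundles using (Bijection)
open import Level using (0ℓ)
open import Relation.Binary.Bundles using (Setoid)
open import Relation.Binary.PropositionalEquality
  using (_≡_; _≢_; refl; sym; trans; setoid; module ≡-Reasoning)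

-- Edges are indexed, so parallel edges are allowed; the order of the two
-- endpoints of an edge carries no meaning, and a loop has both equal.
-- `attach i` is `inj₁ v` if the semiedge i is incident to the vertex v, and
-- `inj₂ j` if i and j together form a free edge.
record Multipole (m : ℕ) : Set where
  field
    #V #E       : ℕ
    ends        : Fin #E → Fin #V × Fin #V
    attach      : Fin m → Fin #V ⊎ Fin m
    partner-≢   : ∀ {i j} → attach i ≡ inj₂ j → i ≢ j
    partner-sym : ∀ {i j} → attach i ≡ inj₂ j → attach j ≡ inj₂ i

  -- A loop contributes to both of the first two summands.
  degree : Fin #V → ℕ
  degree v = count (λ e → proj₁ (ends e) ≟ v) (allFin #E)
           + count (λ e → proj₂ (ends e) ≟ v) (allFin #E)
           + count (λ i → ≡-dec _≟_ _≟_ (attach i) (inj₁ v)) (allFin m)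

  field
    cubic : ∀ v → degree v ≡ 3

  -- The incidences counted by `degree`: a loop is incident twice to its vertex,
  -- through two different half-edges.
  data HalfEdge : Set where
    end₁ end₂ : Fin #E → HalfEdge
    semi      : Fin m → HalfEdge

  attachHalf : HalfEdge → Fin #V ⊎ Fin m
  attachHalf (end₁ e) = inj₁ (proj₁ (ends e))
  attachHalf (end₂ e) = inj₁ (proj₂ (ends e))
  attachHalf (semi i) = attach i

  underlying : HalfEdge → Fin #E ⊎ Fin m
  underlying (end₁ e) = inj₁ e
  underlying (end₂ e) = inj₁ e
  underlying (semi i) = inj₂ i

Color : Set
Color = Fin 3

module _ {m : ℕ} (M : Multipole m) where
  open Multipole M

  record IsTaitColoring (φ : Fin #E ⊎ Fin m → Color) : Set where
    field
      distinct : ∀ {v h k} → attachHalf h ≡ inj₁ v → attachHalf k ≡ inj₁ v →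
                 h ≢ k → φ (underlying h) ≢ φ (underlying k)
      free     : ∀ {i j} → attach i ≡ inj₂ j → φ (inj₂ i) ≡ φ (inj₂ j)

  IsState : Vec Color m → Set
  IsState t = ∃ λ φ → IsTaitColoring φ × tabulate (φ ∘ inj₂) ≡ t

Admissible : ∀ {m} → Vec Color m → Set
Admissible {m} t = ∀ c → count (c ≟_) t % 2 ≡ m % 2

ColorComplete : ∀ {m} → Multipole m → Set
ColorComplete M = ∀ t → Admissible t → IsState M t

infix 4 _∼_

_∼_ : ∀ {m} → Vec Color m → Vec Color m → Set
s ∼ t = ∃ λ (π : Permutation′ 3) → map (π ⟨$⟩ʳ_) s ≡ t

∼-refl : ∀ {m} {s : Vec Color m} → s ∼ s
∼-refl {s = s} = Perm.id , map-id s

∼-sym : ∀ {m} {s t : Vec Color m} → s ∼ t → t ∼ s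
∼-sym {s = s} (π , refl) = flip π , (begin
  map (flip π ⟨$⟩ʳ_) (map (π ⟨$⟩ʳ_) s) ≡⟨ map-∘ _ _ s ⟨
  map (λ c → flip π ⟨$⟩ʳ (π ⟨$⟩ʳ c)) s ≡⟨ map-cong (λ _ → inverseˡ π) s ⟩
  map (λ c → c) s                      ≡⟨ map-id s ⟩
  s                                    ∎)
  where open ≡-Reasoning

∼-trans : ∀ {m} {s t u : Vec Color m} → s ∼ t → t ∼ u → s ∼ u
∼-trans {s = s} (π , refl) (ρ , refl) = π ∘ₚ ρ , map-∘ _ _ s

-- The equivalence ignores the coloring that witnesses a state.
states : ∀ {m} → Multipole m → Setoid 0ℓ 0ℓ
states {m} M = record
  { Carrier       = Σ (Vec Color m) (IsState M)
  ; _≈_           = λ s t → proj₁ s ∼ proj₁ t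
  ; isEquivalence = record { refl = ∼-refl ; sym = ∼-sym ; trans = ∼-trans }
  }

-- A bijection of setoids is a bijection between the equivalence classes.
HasClasses : Setoid 0ℓ 0ℓ → ℕ → Set
HasClasses S n = Bijection S (setoid (Fin n))

HasClasses-unique : ∀ {S k n} → HasClasses S k → HasClasses S n → k ≡ n
HasClasses-unique {S} f g =
  cantor-schröder-bernstein (transfer-injective f g) (transfer-injective g f)
  where
  module B {n} (h : HasClasses S n) = Bijection h

  section : ∀ {n} (h : HasClasses S n) → Fin n → Setoid.Carrier S
  section h i = proj₁ (B.surjective h i)

  section-to : ∀ {n} (h : HasClasses S n) i → B.to h (section h i) ≡ i
  section-to h i = proj₂ (B.surjective h i) (Setoid.refl S)

  transfer-injective : ∀ {k n} (h : HasClasses S k) (h′ : HasClasses S n) →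
    ∀ {i j} → B.to h′ (section h i) ≡ B.to h′ (section h j) → i ≡ j
  transfer-injective h h′ {i} {j} eq =
    trans (sym (section-to h i))
      (trans (B.cong h (B.injective h′ eq)) (section-to h j))

{-# OPTIONS --safe #-}

-- For a color c, count the incident pairs of a vertex and a half-edge of color c: each vertex
-- is in exactly one of them, and each edge of color c in two. The semiedges on free edges come
-- in pairs of the same color, so the number of semiedges of color c has the parity of #V. Summing
-- over the colors, so does m. Hence the states of M are the admissible words.
--
-- View the colors as the nonzero elements of the Klein four-group. A word is admissible iff its
-- sum vanishes, so c ∷ t is admissible iff c is the sum of t, and the classes of admissible words
-- of length m + 1 correspond to the classes of words of length m that are not admissible. There
-- are (3 ^ (m ∸ 1) + 1) / 2 classes of words of length m, so σ (m + 1) + σ m is this number.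
module Submission where

open import Defs
open import Data.List.Base as List
  using (List; []; _∷_; length; filter; cartesianProductWith; allFin)
open import Data.Product.Base using (∃; _×_; _,_; proj₁; proj₂)
open import Relation.Binary.PropositionalEquality hiding ([_])

module Counting where
  open import Data.Bool.Base using (if_then_else_; true; false)
  open import Data.Fin.Base using (Fin; zero; suc)
  open import Data.Fin.Patterns using (0F; 1F; 2F)
  open import Data.Fin.Permutation
    using (Permutation′; _⟨$⟩ʳ_; _⟨$⟩ˡ_; inverseˡ; inverseʳ; transpose)
  open import Data.Fin.Properties using (_≟_; 0≢1+n; suc-injective; all?)
  import Data.List.Membership.Propositional as Propositional
  open import Data.List.Membership.Propositional.Properties
    using (∈-lookup; ∈-cartesianProductWith⁺; ∈-cartesianProductWith⁻; ∈-map⁺; ∈-allFin)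
  import Data.List.Membership.Setoid as Membership
  import Data.List.Membership.Setoid.Properties as Membershipₚ
  open import Data.List.Properties using (length-map; length-++)
  open import Data.List.Relation.Unary.All as All using (All; []; _∷_)
  import Data.List.Relation.Unary.All.Properties as All
  open import Data.List.Relation.Unary.AllPairs using ([]; _∷_)
  open import Data.List.Relation.Unary.Any as Any using (here; there; index)
  import Data.List.Relation.Unary.Any.Properties as Any
  import Data.List.Relation.Unary.Unique.Propositional as Propositional
  import Data.List.Relation.Unary.Unique.Propositional.Properties as Propositional
  open import Data.List.Relation.Unary.Unique.Setoid using (Unique)
  import Data.List.Relation.Unary.Unique.Setoid.Properties as Unique
  open import Data.Maybe.Base using (Maybe; just; nothing; fromMaybe)
  import Data.Maybe.Properties as Maybe
  open import Data.Nat.Base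
  open import Data.Nat.DivMod using ([m+n]%n≡m%n)
  open import Data.Nat.Properties
    using ( ≤-refl; ≤-reflexive; ≤-trans; ≤-antisym; +-mono-≤; +-monoʳ-≤; +-cancelʳ-≤; *-mono-≤
          ; +-comm; +-assoc; +-suc; *-identityˡ; *-identityʳ; *-zeroʳ; *-distribˡ-+; +-*-semiring )
  open import Data.Nat.Tactic.RingSolver using (solve-∀)
  open import Data.Parity.Base as ℙ using (Parity; 0ℙ; 1ℙ)
  import Data.Parity.Properties as ℙ
  open import Data.Sum.Base as Sum using (_⊎_; inj₁; inj₂)
  open import Data.Sum.Properties using (≡-dec)
  open import Data.Unit.Base using (⊤)
  open import Data.Vec.Base as Vec using (Vec; []; _∷_; count; tabulate; replicate)
  open import Data.Vec.Properties using (∷-injectiveˡ; ∷-injectiveʳ; map-replicate)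
  open import Function.Base using (_∘_; id; case_of_)
  open import Function.Bundles using (mk⇔)
  open import Level using (0ℓ)
  open import Relation.Binary.Bundles using (Setoid)
  import Relation.Binary.Construct.On as On
  open import Relation.Binary.Definitions using (_Respects_)
  open import Relation.Nullary using (Dec; yes; no; does; ¬_; ¬?; contradiction)
  open import Relation.Nullary.Decidable using (does-⇔; from-yes; _→-dec_)
  open import Relation.Unary using (Pred; Decidable)

  open import Algebra.Properties.Semiring.Sum +-*-semiring

  -- Sums of indicators, and parities of natural numbers.

  ⟦_⟧ : ∀ {p} {P : Set p} → Dec P → ℕ
  ⟦ P? ⟧ = if does P? then 1 else 0

  ⟦⟧-⇔ : ∀ {p q} {P : Set p} {Q : Set q} (P? : Dec P) (Q? : Dec Q) →
         (P → Q) → (Q → P) → ⟦ P? ⟧ ≡ ⟦ Q? ⟧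
  ⟦⟧-⇔ P? Q? f g = cong (if_then 1 else 0) (does-⇔ (mk⇔ f g) P? Q?)

  *-false : ∀ {p} {P : Set p} n (P? : Dec P) → ¬ P → n * ⟦ P? ⟧ ≡ 0
  *-false n (yes p) ¬p = contradiction p ¬p
  *-false n (no _)  _  = *-zeroʳ n

  ⟦⟧≤1 : ∀ {p} {P : Set p} (P? : Dec P) → ⟦ P? ⟧ ≤ 1
  ⟦⟧≤1 (yes _) = ≤-refl
  ⟦⟧≤1 (no _)  = z≤n

  count-tabulate : ∀ {a p n} {A : Set a} {P : Pred A p} (P? : Decidable P) (f : Fin n → A) →
                   count P? (tabulate f) ≡ ∑[ i < n ] ⟦ P? (f i) ⟧
  count-tabulate {n = zero}  P? f = refl
  count-tabulate {n = suc n} P? f with does (P? (f zero))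
  ... | true  = cong suc (count-tabulate P? (f ∘ suc))
  ... | false = count-tabulate P? (f ∘ suc)

  ∑-zero : ∀ {n} (f : Fin n → ℕ) → (∀ i → f i ≡ 0) → sum f ≡ 0
  ∑-zero {n} f f≡0 = trans (sum-cong-≗ f≡0) (sum-replicate-zero n)

  ∑-one : ∀ {n} (f : Fin n → ℕ) → (∀ i → f i ≡ 1) → sum f ≡ n
  ∑-one {zero}  f f≡1 = refl
  ∑-one {suc n} f f≡1 = cong₂ _+_ (f≡1 zero) (∑-one (f ∘ suc) (f≡1 ∘ suc))

  ∑-⟦≟⟧ : ∀ {n} (x : Fin n) → ∑[ i < n ] ⟦ x ≟ i ⟧ ≡ 1
  ∑-⟦≟⟧ {suc n} zero    = cong suc (∑-zero {n} _ (λ _ → refl))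
  ∑-⟦≟⟧ {suc n} (suc x) = ∑-⟦≟⟧ x

  ∑-⟦≟⟧ˡ : ∀ {n} (x : Fin n) → ∑[ i < n ] ⟦ i ≟ x ⟧ ≡ 1
  ∑-⟦≟⟧ˡ x = trans (sum-cong-≗ (λ i → ⟦⟧-⇔ (i ≟ x) (x ≟ i) sym sym)) (∑-⟦≟⟧ x)

  ∑-positive : ∀ {n} (f : Fin n → ℕ) → 0 < sum f → ∃ λ i → 0 < f i
  ∑-positive {suc n} f 0<∑ with f zero in eq
  ... | suc _ = zero , subst (0 <_) (sym eq) z<s
  ... | zero  with i , 0<fi ← ∑-positive (f ∘ suc) 0<∑ = suc i , 0<fi

  +-≤1 : ∀ {a b} → a ≤ 1 → b ≤ 1 → ¬ (0 < a × 0 < b) → a + b ≤ 1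
  +-≤1 {zero}                  _ b≤1 _    = b≤1
  +-≤1 {suc zero} {zero}       _ _   _    = ≤-refl
  +-≤1 {suc zero} {suc b}      _ _   excl = contradiction (z<s , z<s) excl
  +-≤1 {suc (suc _)}           (s≤s ()) _ _

  ∑-≤1 : ∀ {n} (f : Fin n → ℕ) → (∀ i → f i ≤ 1) →
         (∀ {i j} → i ≢ j → ¬ (0 < f i × 0 < f j)) → sum f ≤ 1
  ∑-≤1 {zero}  f f≤1 excl = z≤n
  ∑-≤1 {suc n} f f≤1 excl = +-≤1 (f≤1 zero)
    (∑-≤1 (f ∘ suc) (f≤1 ∘ suc) (λ i≢j → excl (i≢j ∘ suc-injective)))
    (λ (p , q) → excl 0≢1+n (p , proj₂ (∑-positive (f ∘ suc) q)))

  -- A zero term could not be made up for by the others. Applied to the three colors at a vertex, it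
  -- turns "at most once" into "exactly once".
  ∑≡n⇒≡1 : ∀ {n} (f : Fin n → ℕ) → (∀ i → f i ≤ 1) → sum f ≡ n → ∀ i → f i ≡ 1
  ∑≡n⇒≡1 {suc n} f f≤1 ∑≡ = λ where
      zero    → f₀≡1
      (suc i) → ∑≡n⇒≡1 (f ∘ suc) (f≤1 ∘ suc)
                  (cong pred (trans (cong (_+ sum (f ∘ suc)) (sym f₀≡1)) ∑≡)) i
    where
    ∑≤ : ∀ {n} (f : Fin n → ℕ) → (∀ i → f i ≤ 1) → sum f ≤ n
    ∑≤ {zero}  f _   = z≤n
    ∑≤ {suc n} f f≤1 = +-mono-≤ (f≤1 zero) (∑≤ (f ∘ suc) (f≤1 ∘ suc))

    f₀≡1 : f zero ≡ 1
    f₀≡1 = ≤-antisym (f≤1 zero) (+-cancelʳ-≤ n 1 (f zero)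
      (≤-trans (≤-reflexive (sym ∑≡)) (+-monoʳ-≤ (f zero) (∑≤ (f ∘ suc) (f≤1 ∘ suc)))))

  -- The entries at (i, j) and (j, i) cancel modulo 2. The induction strips the first row and the
  -- first column, which have equal sums.
  ∑∑-symmetric-even : ∀ {n} (g : Fin n → Fin n → ℕ) → (∀ i j → g i j ≡ g j i) → (∀ i → g i i ≡ 0) →
                      parity (∑[ i < n ] ∑[ j < n ] g i j) ≡ 0ℙ
  ∑∑-symmetric-even {zero}  g g-sym g-diag = refl
  ∑∑-symmetric-even {suc n} g g-sym g-diag = begin
    parity (g zero zero + row + ∑[ i < n ] (g (suc i) zero + ∑[ j < n ] g (suc i) (suc j)))
      ≡⟨ cong parity (cong₂ (λ x y → x + row + y) (g-diag zero)
                                                   (∑-distrib-+ (λ i → g (suc i) zero) _)) ⟩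
    parity (row + (∑[ i < n ] g (suc i) zero + rest))
      ≡⟨ cong (λ x → parity (row + (x + rest))) (sum-cong-≗ (λ i → g-sym (suc i) zero)) ⟩
    parity (row + (row + rest))
      ≡⟨ trans (ℙ.+-homo-+ row _) (cong (parity row ℙ.+_) (ℙ.+-homo-+ row rest)) ⟩
    parity row ℙ.+ (parity row ℙ.+ parity rest)
      ≡⟨ cong (λ p → parity row ℙ.+ (parity row ℙ.+ p))
              (∑∑-symmetric-even _ (λ i j → g-sym (suc i) (suc j)) (g-diag ∘ suc)) ⟩
    parity row ℙ.+ (parity row ℙ.+ 0ℙ)
      ≡⟨ double (parity row) ⟩
    0ℙ ∎
    where
    open ≡-Reasoning
    row = ∑[ j < n ] g zero (suc j)
    rest = ∑[ i < n ] ∑[ j < n ] g (suc i) (suc j)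
    double : ∀ p → p ℙ.+ (p ℙ.+ 0ℙ) ≡ 0ℙ
    double 0ℙ = refl
    double 1ℙ = refl

  residue : Parity → ℕ
  residue 0ℙ = 0
  residue 1ℙ = 1

  %2≡residue : ∀ n → n % 2 ≡ residue (parity n)
  %2≡residue 0 = refl
  %2≡residue 1 = refl
  %2≡residue (suc (suc n)) =
    trans (cong (_% 2) (+-comm 2 n)) (trans ([m+n]%n≡m%n n 2) (%2≡residue n))

  parity⇒%2 : ∀ m n → parity m ≡ parity n → m % 2 ≡ n % 2
  parity⇒%2 m n eq = trans (%2≡residue m) (trans (cong residue eq) (sym (%2≡residue n)))

  %2⇒parity : ∀ m n → m % 2 ≡ n % 2 → parity m ≡ parity n
  %2⇒parity m n eq = residue-injective (trans (sym (%2≡residue m)) (trans eq (%2≡residue n)))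
    where
    residue-injective : ∀ {p q} → residue p ≡ residue q → p ≡ q
    residue-injective {0ℙ} {0ℙ} _ = refl
    residue-injective {1ℙ} {1ℙ} _ = refl

  -- The Parity Lemma: every state is admissible.

  module ParityLemma {m} (M : Multipole m) where
    open Multipole M

    -- The summands are ordered as in `degree`, so that `cubic` evaluates the sum of the incidences
    -- at a vertex.
    ∑ₕ : (HalfEdge → ℕ) → ℕ
    ∑ₕ f = ∑[ e < #E ] f (end₁ e) + ∑[ e < #E ] f (end₂ e) + ∑[ i < m ] f (semi i)

    ∑ₕ-cong : ∀ {f g} → (∀ h → f h ≡ g h) → ∑ₕ f ≡ ∑ₕ g
    ∑ₕ-cong f≗g = cong₂ _+_ (cong₂ _+_ (sum-cong-≗ (f≗g ∘ end₁)) (sum-cong-≗ (f≗g ∘ end₂)))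
                            (sum-cong-≗ (f≗g ∘ semi))

    ∑-∑ₕ-comm : ∀ {n} (f : Fin n → HalfEdge → ℕ) → ∑[ i < n ] ∑ₕ (f i) ≡ ∑ₕ (λ h → ∑[ i < n ] f i h)
    ∑-∑ₕ-comm {n} f = begin
      ∑[ i < n ] (a i + b i + c i)               ≡⟨ ∑-distrib-+ (λ i → a i + b i) c ⟩
      ∑[ i < n ] (a i + b i) + ∑[ i < n ] c i    ≡⟨ cong (_+ sum c) (∑-distrib-+ a b) ⟩
      sum a + sum b + sum c
        ≡⟨ cong₂ _+_ (cong₂ _+_ (∑-comm (λ i → f i ∘ end₁)) (∑-comm (λ i → f i ∘ end₂)))
                   (∑-comm (λ i → f i ∘ semi)) ⟩
      ∑ₕ (λ h → ∑[ i < n ] f i h)                ∎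
      where
      open ≡-Reasoning
      a b c : Fin n → ℕ
      a i = ∑[ e < #E ] f i (end₁ e)
      b i = ∑[ e < #E ] f i (end₂ e)
      c i = ∑[ j < m ] f i (semi j)

    ∑ₕ-≤1 : ∀ {f} → (∀ h → f h ≤ 1) → (∀ {h k} → h ≢ k → ¬ (0 < f h × 0 < f k)) → ∑ₕ f ≤ 1
    ∑ₕ-≤1 {f} f≤1 excl =
      +-≤1 (+-≤1 (part end₁ λ { refl → refl }) (part end₂ λ { refl → refl })
                 (disjoint end₁ end₂ λ ()))
           (part semi λ { refl → refl })
           (λ (p , q) → case 0<m+n⇒0<m⊎0<n p of λ where
             (inj₁ p₁) → disjoint end₁ semi (λ ()) (p₁ , q)
             (inj₂ p₂) → disjoint end₂ semi (λ ()) (p₂ , q))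
      where
      part : ∀ {n} (ι : Fin n → HalfEdge) → (∀ {i j} → ι i ≡ ι j → i ≡ j) → sum (f ∘ ι) ≤ 1
      part ι ι-inj = ∑-≤1 (f ∘ ι) (f≤1 ∘ ι) (λ i≢j → excl (i≢j ∘ ι-inj))

      disjoint : ∀ {k n} (ι : Fin k → HalfEdge) (κ : Fin n → HalfEdge) → (∀ {i j} → ι i ≢ κ j) →
                 ¬ (0 < sum (f ∘ ι) × 0 < sum (f ∘ κ))
      disjoint ι κ ι≢κ (p , q) =
        excl ι≢κ (proj₂ (∑-positive (f ∘ ι) p) , proj₂ (∑-positive (f ∘ κ) q))

      0<m+n⇒0<m⊎0<n : ∀ {m n} → 0 < m + n → 0 < m ⊎ 0 < n
      0<m+n⇒0<m⊎0<n {zero}  0<n = inj₂ 0<n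
      0<m+n⇒0<m⊎0<n {suc m} _   = inj₁ z<s

    _≟ₐ_ : (x y : Fin #V ⊎ Fin m) → Dec (x ≡ y)
    _≟ₐ_ = ≡-dec _≟_ _≟_

    at : HalfEdge → Fin #V → ℕ
    at h v = ⟦ attachHalf h ≟ₐ inj₁ v ⟧

    ∑ₕ-at : ∀ v → ∑ₕ (λ h → at h v) ≡ 3
    ∑ₕ-at v = trans (sym (cong₂ _+_ (cong₂ _+_ (count-tabulate (λ e → proj₁ (ends e) ≟ v) id)
                                              (count-tabulate (λ e → proj₂ (ends e) ≟ v) id))
                                    (count-tabulate (λ i → attach i ≟ₐ inj₁ v) id)))
                    (cubic v)

    paired : Fin m → Fin m → ℕ
    paired i j = ⟦ attach i ≟ₐ inj₂ j ⟧

    -- A semiedge has either one vertex or one partner; this separates the semiedges at vertices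
    -- from those on free edges.
    ∑-attach : ∀ (x : Fin #V ⊎ Fin m) → ∑[ v < #V ] ⟦ x ≟ₐ inj₁ v ⟧ + ∑[ j < m ] ⟦ x ≟ₐ inj₂ j ⟧ ≡ 1
    ∑-attach (inj₁ u) = cong₂ _+_ (∑-⟦≟⟧ u) (∑-zero {m} _ (λ _ → refl))
    ∑-attach (inj₂ i) = cong₂ _+_ (∑-zero {#V} _ (λ _ → refl)) (∑-⟦≟⟧ i)

    module _ {φ} (isTait : IsTaitColoring M φ) where
      open IsTaitColoring isTait

      hue : Color → HalfEdge → ℕ
      hue c h = ⟦ c ≟ φ (underlying h) ⟧

      hued : Color → ℕ
      hued c = ∑[ i < m ] hue c (semi i)

      -- The three half-edges at v have distinct colors, and there are only three colors.
      ∑ₕ-hue-at : ∀ v c → ∑ₕ (λ h → hue c h * at h v) ≡ 1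
      ∑ₕ-hue-at v = ∑≡n⇒≡1 _ (λ c → ∑ₕ-≤1 (≤1 c) (excl c)) (begin
        ∑[ c < 3 ] ∑ₕ (λ h → hue c h * at h v)
          ≡⟨ ∑-∑ₕ-comm (λ c h → hue c h * at h v) ⟩
        ∑ₕ (λ h → ∑[ c < 3 ] (hue c h * at h v))
          ≡⟨ ∑ₕ-cong (λ h → *-distribʳ-sum {3} (at h v) (λ c → hue c h)) ⟨
        ∑ₕ (λ h → ∑[ c < 3 ] hue c h * at h v)
          ≡⟨ ∑ₕ-cong (λ h → trans (cong (_* at h v) (∑-⟦≟⟧ˡ (φ (underlying h)))) (*-identityˡ _)) ⟩
        ∑ₕ (λ h → at h v)
          ≡⟨ ∑ₕ-at v ⟩
        3 ∎)
        where
        open ≡-Reasoning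
        ≤1 : ∀ c h → hue c h * at h v ≤ 1
        ≤1 c h = *-mono-≤ (⟦⟧≤1 (c ≟ φ (underlying h))) (⟦⟧≤1 (attachHalf h ≟ₐ inj₁ v))

        excl : ∀ c {h k} → h ≢ k → ¬ (0 < hue c h * at h v × 0 < hue c k * at k v)
        excl c {h} {k} h≢k (p , q) with c ≟ φ (underlying h) | attachHalf h ≟ₐ inj₁ v
        excl c {h} {k} h≢k (() , q) | no _  | _
        excl c {h} {k} h≢k (() , q) | yes _ | no _
        ... | yes c≡h | yes h-at-v with c ≟ φ (underlying k) | attachHalf k ≟ₐ inj₁ v
        excl c {h} {k} h≢k (p , ()) | yes _ | yes _ | no _  | _
        excl c {h} {k} h≢k (p , ()) | yes _ | yes _ | yes _ | no _
        ... | yes c≡k | yes k-at-v = distinct h-at-v k-at-v h≢k (trans (sym c≡h) c≡k)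

      -- Partners have the same color, so the summand is symmetric in i and j, and no semiedge is
      -- its own partner.
      hue-free-even : ∀ c → parity (∑[ i < m ] ∑[ j < m ] (hue c (semi i) * paired i j)) ≡ 0ℙ
      hue-free-even c = ∑∑-symmetric-even _ symmetric diagonal
        where
        diagonal : ∀ i → hue c (semi i) * paired i i ≡ 0
        diagonal i = *-false (hue c (semi i)) (attach i ≟ₐ inj₂ i) (λ eq → partner-≢ eq refl)

        symmetric : ∀ i j → hue c (semi i) * paired i j ≡ hue c (semi j) * paired j i
        symmetric i j with attach i ≟ₐ inj₂ j
        ... | yes eq = cong₂ _*_ (cong (λ d → ⟦ c ≟ d ⟧) (free eq))
                                 (⟦⟧-⇔ (yes eq) (attach j ≟ₐ inj₂ i) partner-sym partner-sym)
        ... | no neq = trans (*-zeroʳ (hue c (semi i)))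
                     (sym (*-false (hue c (semi j)) (attach j ≟ₐ inj₂ i) (neq ∘ partner-sym)))

      -- In color c there are `X` edges, `A` semiedges at vertices and `Y` semiedges on free edges.
      -- Color c occurs once at each vertex, so `X + X + A` is `#V`, and `Y` is even.
      hued-parity : ∀ c → parity (hued c) ≡ parity #V
      hued-parity c = begin
        parity (hued c)
          -- Adding `X` twice changes nothing modulo 2 and completes `A` to the number of incidences
          -- of color c.
          ≡⟨ double (parity X) (parity (hued c)) ⟨
        (parity X ℙ.+ parity X) ℙ.+ parity (hued c)
          ≡⟨ cong (ℙ._+ parity (hued c)) (ℙ.+-homo-+ X X) ⟨
        parity (X + X) ℙ.+ parity (hued c)
          ≡⟨ ℙ.+-homo-+ (X + X) (hued c) ⟨
        parity (X + X + hued c)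
          ≡⟨ cong (λ x → parity (X + X + x)) hued≡A+Y ⟩
        parity (X + X + (A + Y))
          ≡⟨ cong parity (+-assoc (X + X) A Y) ⟨
        parity (X + X + A + Y)
          ≡⟨ cong (λ x → parity (x + Y)) X+X+A≡#V ⟩
        parity (#V + Y)
          ≡⟨ ℙ.+-homo-+ #V Y ⟩
        parity #V ℙ.+ parity Y
          ≡⟨ cong (parity #V ℙ.+_) (hue-free-even c) ⟩
        parity #V ℙ.+ 0ℙ
          ≡⟨ ℙ.+-identityʳ _ ⟩
        parity #V ∎
        where
        open ≡-Reasoning
        X = ∑[ e < #E ] hue c (end₁ e)
        A = ∑[ i < m ] (hue c (semi i) * ∑[ v < #V ] at (semi i) v)
        Y = ∑[ i < m ] ∑[ j < m ] (hue c (semi i) * paired i j)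

        double : ∀ p q → (p ℙ.+ p) ℙ.+ q ≡ q
        double 0ℙ q = refl
        double 1ℙ q = refl

        split : ∀ i → hue c (semi i) ≡
          hue c (semi i) * ∑[ v < #V ] at (semi i) v + hue c (semi i) * ∑[ j < m ] paired i j
        split i = begin
          hue c (semi i)
            ≡⟨ *-identityʳ _ ⟨
          hue c (semi i) * 1
            ≡⟨ cong (hue c (semi i) *_) (∑-attach (attach i)) ⟨
          hue c (semi i) * (∑[ v < #V ] at (semi i) v + ∑[ j < m ] paired i j)
            ≡⟨ *-distribˡ-+ (hue c (semi i)) _ _ ⟩
          hue c (semi i) * ∑[ v < #V ] at (semi i) v + hue c (semi i) * ∑[ j < m ] paired i j ∎

        hued≡A+Y : hued c ≡ A + Y
        hued≡A+Y = begin
          hued c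
            ≡⟨ sum-cong-≗ split ⟩
          ∑[ i < m ] (hue c (semi i) * ∑[ v < #V ] at (semi i) v
                      + hue c (semi i) * ∑[ j < m ] paired i j)
            ≡⟨ ∑-distrib-+ _ (λ i → hue c (semi i) * ∑[ j < m ] paired i j) ⟩
          A + ∑[ i < m ] (hue c (semi i) * ∑[ j < m ] paired i j)
            ≡⟨ cong (A +_) (sum-cong-≗ (λ i → *-distribˡ-sum (hue c (semi i)) (paired i))) ⟩
          A + Y ∎

        at-end₁ : ∀ e → hue c (end₁ e) ≡ hue c (end₁ e) * ∑[ v < #V ] at (end₁ e) v
        at-end₁ e = sym (trans (cong (hue c (end₁ e) *_) (∑-⟦≟⟧ (proj₁ (ends e)))) (*-identityʳ _))

        at-end₂ : ∀ e → hue c (end₂ e) ≡ hue c (end₂ e) * ∑[ v < #V ] at (end₂ e) v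
        at-end₂ e = sym (trans (cong (hue c (end₂ e) *_) (∑-⟦≟⟧ (proj₂ (ends e)))) (*-identityʳ _))

        X+X+A≡#V : X + X + A ≡ #V
        X+X+A≡#V = begin
          X + X + A
            -- Both halves of an edge carry its color, so the second `X` is also the sum over the
            -- halves `end₂`.
            ≡⟨ cong (_+ A) (cong₂ _+_ (sum-cong-≗ at-end₁) (sum-cong-≗ at-end₂)) ⟩
          ∑ₕ (λ h → hue c h * ∑[ v < #V ] at h v)
            ≡⟨ ∑ₕ-cong (λ h → *-distribˡ-sum (hue c h) (at h)) ⟩
          ∑ₕ (λ h → ∑[ v < #V ] (hue c h * at h v))
            ≡⟨ ∑-∑ₕ-comm (λ v h → hue c h * at h v) ⟨
          ∑[ v < #V ] ∑ₕ (λ h → hue c h * at h v)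
            ≡⟨ ∑-one _ (λ v → ∑ₕ-hue-at v c) ⟩
          #V ∎

      -- The three color counts sum to m and each has the parity of `#V`; three times a parity is
      -- that parity.
      m-parity : parity m ≡ parity #V
      m-parity = begin
        parity m
          ≡⟨ cong parity (∑-one _ (λ i → ∑-⟦≟⟧ˡ (φ (inj₂ i)))) ⟨
        parity (∑[ i < m ] ∑[ c < 3 ] hue c (semi i))
          ≡⟨ cong parity (∑-comm (λ i c → hue c (semi i))) ⟩
        parity (hued 0F + (hued 1F + (hued 2F + 0)))
          ≡⟨ ∑₃ ⟩
        p ℙ.+ (p ℙ.+ (p ℙ.+ 0ℙ))
          ≡⟨ triple p ⟩
        p ∎
        where
        open ≡-Reasoning
        p = parity #V

        ∑₃ : parity (hued 0F + (hued 1F + (hued 2F + 0))) ≡ p ℙ.+ (p ℙ.+ (p ℙ.+ 0ℙ))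
        ∑₃ = +-cong (hued 0F) (hued-parity 0F)
               (+-cong (hued 1F) (hued-parity 1F) (+-cong (hued 2F) {0} (hued-parity 2F) refl))
          where
          +-cong : ∀ a {b p q} → parity a ≡ p → parity b ≡ q → parity (a + b) ≡ p ℙ.+ q
          +-cong a {b} eq eq′ = trans (ℙ.+-homo-+ a b) (cong₂ ℙ._+_ eq eq′)

        triple : ∀ p → p ℙ.+ (p ℙ.+ (p ℙ.+ 0ℙ)) ≡ p
        triple 0ℙ = refl
        triple 1ℙ = refl

    state⇒admissible : ∀ {t} → IsState M t → Admissible t
    state⇒admissible (φ , isTait , refl) c = parity⇒%2 (count (c ≟_) (tabulate (φ ∘ inj₂))) m (begin
      parity (count (c ≟_) (tabulate (φ ∘ inj₂)))
        ≡⟨ cong parity (count-tabulate (c ≟_) (φ ∘ inj₂)) ⟩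
      parity (hued isTait c)
        ≡⟨ hued-parity isTait c ⟩
      parity #V
        ≡⟨ m-parity isTait ⟨
      parity m ∎)
      where open ≡-Reasoning

  -- List lengths, and transversals of equivalence relations.

  length-cartesianProductWith : ∀ {a b c} {A : Set a} {B : Set b} {C : Set c}
                                (f : A → B → C) xs ys →
                                length (cartesianProductWith f xs ys) ≡ length xs * length ys
  length-cartesianProductWith f []       ys = refl
  length-cartesianProductWith f (x ∷ xs) ys =
    trans (length-++ (List.map (f x) ys))
          (cong₂ _+_ (length-map (f x) ys) (length-cartesianProductWith f xs ys))

  length-filter-¬? : ∀ {a p} {A : Set a} {P : Pred A p} (P? : Decidable P) xs →
                     length (filter (¬? ∘ P?) xs) + length (filter P? xs) ≡ length xs
  length-filter-¬? P? []       = refl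
  length-filter-¬? P? (x ∷ xs) with does (P? x)
  ... | true  = trans (+-suc _ _) (cong suc (length-filter-¬? P? xs))
  ... | false = cong suc (length-filter-¬? P? xs)

  -- Proofs of the predicate are ignored by the equivalence, so that `states M` is the restriction
  -- of `words` to `IsState M` by computation.
  restrict : (S : Setoid 0ℓ 0ℓ) → Pred (Setoid.Carrier S) 0ℓ → Setoid 0ℓ 0ℓ
  restrict S P = On.setoid S (proj₁ {B = P})

  module _ (S : Setoid 0ℓ 0ℓ) where
    open Setoid S renaming (Carrier to A; refl to ≈-refl; sym to ≈-sym; trans to ≈-trans)
    open Membership S using (_∈_)

    -- One representative, itself in `P`, for each class that meets `P`.
    record IsTransversal (P : Pred A 0ℓ) (xs : List A) : Set where
      field
        sound  : All P xs
        unique : Unique S xs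
        cover  : ∀ {x} → P x → x ∈ xs

    -- Two different positions for x would hold equivalent entries. Hence sending an element to the
    -- position of its representative is well defined on classes.
    index-unique : ∀ {xs x} → Unique S xs → (x∈xs : x ∈ xs) →
                   ∀ i → x ≈ List.lookup xs i → index x∈xs ≡ i
    index-unique _              (here _)     zero    _   = refl
    index-unique (y≉ ∷ _)       (here x≈y)   (suc i) x≈z =
      contradiction (≈-trans (≈-sym x≈y) x≈z) (All.lookup y≉ (∈-lookup i))
    index-unique (y≉ ∷ _)       (there x∈xs) zero    x≈y =
      let y≉z , x≈z = All.lookupAny y≉ x∈xs in contradiction (≈-trans (≈-sym x≈y) x≈z) y≉z
    index-unique (_ ∷ unique)   (there x∈xs) (suc i) x≈z = cong suc (index-unique unique x∈xs i x≈z)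

    transversal⇒hasClasses : ∀ {P xs} → IsTransversal P xs → HasClasses (restrict S P) (length xs)
    transversal⇒hasClasses {P} {xs} tr = record
      { to        = λ (x , Px) → index (cover Px)
      ; cong      = λ { {_ , Px} {_ , Py} x≈y →
          index-unique unique (cover Px) _ (≈-trans x≈y (Any.lookup-index (cover Py))) }
      ; bijective = (λ { {_ , Px} {_ , Py} → Membershipₚ.index-injective S (cover Px) (cover Py) })
                  , (λ i → (List.lookup xs i , All.lookup sound (∈-lookup i))
                         , λ { {_ , Pz} z≈ → index-unique unique (cover Pz) i z≈ })
      }
      where open IsTransversal tr

    -- Both lengths count the same classes. The recurrence comes from comparing two enumerations in
    -- this way.
    transversal-length : ∀ {P xs ys} → IsTransversal P xs → IsTransversal P ys →
                         length xs ≡ length ys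
    transversal-length {P} tr tr′ =
      HasClasses-unique {restrict S P} (transversal⇒hasClasses tr) (transversal⇒hasClasses tr′)

    transversal-resp : ∀ {P Q xs} → (∀ {x} → P x → Q x) → (∀ {x} → Q x → P x) →
                       IsTransversal P xs → IsTransversal Q xs
    transversal-resp P⇒Q Q⇒P tr = record
      { sound = All.map P⇒Q sound ; unique = unique ; cover = cover ∘ Q⇒P }
      where open IsTransversal tr

    -- Since `Q` is invariant, the representative of an element of `Q` survives the filter.
    transversal-filter : ∀ {P Q xs} (Q? : Decidable Q) → Q Respects _≈_ → (∀ {x} → Q x → P x) →
                         IsTransversal P xs → IsTransversal Q (filter Q? xs)
    transversal-filter {xs = xs} Q? resp Q⇒P tr = record
      { sound  = All.all-filter Q? xs
      ; unique = Unique.filter⁺ S Q? unique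
      ; cover  = λ Qx → Membershipₚ.∈-filter⁺ S Q? resp (cover (Q⇒P Qx)) Qx
      }
      where open IsTransversal tr

  -- Words, their sums in the Klein four-group, and admissibility.

  words : ℕ → Setoid 0ℓ 0ℓ
  words n = record
    { Carrier       = Vec Color n
    ; _≈_           = _∼_
    ; isEquivalence = record { refl = ∼-refl ; sym = ∼-sym ; trans = ∼-trans }
    }

  infixr 5 _⊕_

  -- Colors are the nonzero elements of the Klein four-group and `nothing` is its identity.
  _⊕_ : Color → Maybe Color → Maybe Color
  c  ⊕ nothing = just c
  0F ⊕ just 0F = nothing
  0F ⊕ just 1F = just 2F
  0F ⊕ just 2F = just 1F
  1F ⊕ just 0F = just 2F
  1F ⊕ just 1F = nothing
  1F ⊕ just 2F = just 0F
  2F ⊕ just 0F = just 1F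
  2F ⊕ just 1F = just 0F
  2F ⊕ just 2F = nothing

  ⊕-self : ∀ c → c ⊕ just c ≡ nothing
  ⊕-self = from-yes (all? λ c → Maybe.≡-dec _≟_ (c ⊕ just c) nothing)

  -- Every element of the Klein group is its own inverse.
  ⊕-nothing⁻ : ∀ c x → c ⊕ x ≡ nothing → x ≡ just c
  ⊕-nothing⁻ c (just d) = from-yes (all? λ c → all? λ d →
    Maybe.≡-dec _≟_ (c ⊕ just d) nothing →-dec Maybe.≡-dec _≟_ (just d) (just c)) c d

  total : ∀ {n} → Vec Color n → Maybe Color
  total = Vec.foldr′ _⊕_ nothing

  Balanced : ∀ {n} → Vec Color n → Set
  Balanced t = total t ≡ nothing

  balanced? : ∀ {n} → Decidable (Balanced {n})
  balanced? t = Maybe.≡-dec _≟_ (total t) nothing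

  -- The parity of the number of entries other than c, as a character of the Klein group.
  χ : Color → Maybe Color → Parity
  χ c nothing  = 0ℙ
  χ c (just d) = if does (c ≟ d) then 0ℙ else 1ℙ

  χ-⊕ : ∀ c d x → χ c (d ⊕ x) ≡ χ c (just d) ℙ.+ χ c x
  χ-⊕ c d nothing  = sym (ℙ.+-identityʳ _)
  χ-⊕ c d (just e) = from-yes (all? λ c → all? λ d → all? λ e →
    χ c (d ⊕ just e) ℙ.≟ χ c (just d) ℙ.+ χ c (just e)) c d e

  -- Modulo 2, the number of entries other than c is the count of c plus n. Both sides are additive
  -- over the letters.
  χ-total : ∀ {n} c (t : Vec Color n) → parity (count (c ≟_) t) ℙ.+ parity n ≡ χ c (total t)
  χ-total c []              = refl
  χ-total {suc n} c (d ∷ t) = begin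
    parity (count (c ≟_) (d ∷ t)) ℙ.+ parity (suc n)  ≡⟨ step ⟩
    χ c (just d) ℙ.+ (parity k ℙ.+ parity n)          ≡⟨ cong (χ c (just d) ℙ.+_) (χ-total c t) ⟩
    χ c (just d) ℙ.+ χ c (total t)                    ≡⟨ χ-⊕ c d (total t) ⟨
    χ c (d ⊕ total t)                                 ∎
    where
    open ≡-Reasoning
    k = count (c ≟_) t

    step : parity (count (c ≟_) (d ∷ t)) ℙ.+ parity (suc n) ≡
           χ c (just d) ℙ.+ (parity k ℙ.+ parity n)
    step rewrite ℙ.+-homo-+ 1 n with does (c ≟ d)
    ... | true rewrite ℙ.+-homo-+ 1 k with parity k | parity n
    ...   | 0ℙ | 0ℙ = refl
    ...   | 0ℙ | 1ℙ = refl
    ...   | 1ℙ | 0ℙ = refl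
    ...   | 1ℙ | 1ℙ = refl
    step | false with parity k | parity n
    ...   | 0ℙ | 0ℙ = refl
    ...   | 0ℙ | 1ℙ = refl
    ...   | 1ℙ | 0ℙ = refl
    ...   | 1ℙ | 1ℙ = refl

  -- Admissibility makes every `χ c` vanish on the sum, and a nonzero element d is detected by `χ c`
  -- for any c other than d.
  admissible⇒balanced : ∀ {n} {t : Vec Color n} → Admissible t → Balanced t
  admissible⇒balanced {n} {t} adm = χ-zero (total t) λ c →
    trans (sym (χ-total c t))
          (trans (cong (ℙ._+ parity n) (%2⇒parity (count (c ≟_) t) n (adm c))) (p+p≡0 (parity n)))
    where
    χ-zero : ∀ x → (∀ c → χ c x ≡ 0ℙ) → x ≡ nothing
    χ-zero nothing   _ = refl
    χ-zero (just 0F) z with () ← z 1F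
    χ-zero (just 1F) z with () ← z 0F
    χ-zero (just 2F) z with () ← z 0F

    p+p≡0 : ∀ p → p ℙ.+ p ≡ 0ℙ
    p+p≡0 0ℙ = refl
    p+p≡0 1ℙ = refl

  balanced⇒admissible : ∀ {n} {t : Vec Color n} → Balanced t → Admissible t
  balanced⇒admissible {n} {t} bal c =
    parity⇒%2 (count (c ≟_) t) n (p+q≡0⇒p≡q (trans (χ-total c t) (cong (χ c) bal)))
    where
    p+q≡0⇒p≡q : ∀ {p q} → p ℙ.+ q ≡ 0ℙ → p ≡ q
    p+q≡0⇒p≡q {0ℙ} {0ℙ} _ = refl
    p+q≡0⇒p≡q {1ℙ} {1ℙ} _ = refl

  count-permute : ∀ {n} (π : Permutation′ 3) c (t : Vec Color n) →
                  count (c ≟_) (Vec.map (π ⟨$⟩ʳ_) t) ≡ count ((π ⟨$⟩ˡ c) ≟_) t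
  count-permute π c []      = refl
  count-permute π c (d ∷ t) = cong₂ (λ b k → (if b then suc else id) k)
    (does-⇔ (mk⇔ (λ { refl → inverseˡ π }) (λ { refl → sym (inverseʳ π) }))
            (c ≟ (π ⟨$⟩ʳ d)) ((π ⟨$⟩ˡ c) ≟ d))
    (count-permute π c t)

  admissible-resp-∼ : ∀ {n} {s t : Vec Color n} → s ∼ t → Admissible s → Admissible t
  admissible-resp-∼ {s = s} (π , refl) adm c =
    trans (cong (_% 2) (count-permute π c s)) (adm (π ⟨$⟩ˡ c))

  -- Color permutations are automorphisms of the Klein group. The proof passes through
  -- admissibility, where a permutation merely renames the three counts.
  balanced-resp-∼ : ∀ {n} {s t : Vec Color n} → s ∼ t → Balanced s → Balanced t
  balanced-resp-∼ {s = s} {t} s∼t bal =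
    admissible⇒balanced {t = t} (admissible-resp-∼ s∼t (balanced⇒admissible {t = s} bal))

  -- Enumeration of all words up to color permutation.

  zeros : ∀ k → Vec Color (suc k)
  zeros k = replicate (suc k) 0F

  -- Codes for the words with at least two colors, up to a permutation of the colors: read from
  -- the right, such a word is normalized so that its first color is 0F and its second 1F.
  data Pattern : ℕ → Set where
    first : ∀ {k} → Pattern (suc k)
    _◂_   : ∀ {k} → Color → Pattern k → Pattern (suc k)

  -- `first` marks the rightmost place where a second color appears: only 0F stands to its right,
  -- and the letters to its left are arbitrary.
  word : ∀ {k} → Pattern k → Vec Color (suc k)
  word first   = 1F ∷ zeros _
  word (c ◂ p) = c ∷ word p

  ∷-∼⁻ : ∀ {n c d} {s t : Vec Color n} → c ∷ s ∼ d ∷ t → s ∼ t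
  ∷-∼⁻ (π , eq) = π , ∷-injectiveʳ eq

  zeros≁word : ∀ {k} (p : Pattern k) → ¬ (zeros k ∼ word p)
  zeros≁word first   (π , eq)
    with () ← trans (sym (∷-injectiveˡ eq)) (∷-injectiveˡ (∷-injectiveʳ eq))
  zeros≁word (c ◂ p) eq       = zeros≁word p (∷-∼⁻ eq)

  -- A word with two colors has a trivial stabilizer, as the third color has nowhere else to go.
  word-rigid : ∀ {k} (p : Pattern k) (π : Permutation′ 3) →
               Vec.map (π ⟨$⟩ʳ_) (word p) ≡ word p → ∀ c → π ⟨$⟩ʳ c ≡ c
  word-rigid (_ ◂ p) π eq = word-rigid p π (∷-injectiveʳ eq)
  word-rigid first   π eq = fixed
    where
    π0≡0 : π ⟨$⟩ʳ 0F ≡ 0F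
    π0≡0 = ∷-injectiveˡ (∷-injectiveʳ eq)

    π1≡1 : π ⟨$⟩ʳ 1F ≡ 1F
    π1≡1 = ∷-injectiveˡ eq

    injective : ∀ {c d} → π ⟨$⟩ʳ c ≡ π ⟨$⟩ʳ d → c ≡ d
    injective eq = trans (sym (inverseˡ π)) (trans (cong (π ⟨$⟩ˡ_) eq) (inverseˡ π))

    fixed : ∀ c → π ⟨$⟩ʳ c ≡ c
    fixed 0F = π0≡0
    fixed 1F = π1≡1
    fixed 2F with π ⟨$⟩ʳ 2F in π2
    ... | 0F with () ← injective (trans π2 (sym π0≡0))
    ... | 1F with () ← injective (trans π2 (sym π1≡1))
    ... | 2F = refl

  -- By induction the tails agree; the permutation then fixes a word with two colors, so it is the
  -- identity and the heads agree too. In the mixed cases one tail is constant and the other is not.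
  word-∼-injective : ∀ {k} {p q : Pattern k} → word p ∼ word q → p ≡ q
  word-∼-injective {p = first} {first} _   = refl
  word-∼-injective {p = first} {d ◂ q} p∼q = contradiction (∷-∼⁻ p∼q) (zeros≁word q)
  word-∼-injective {p = c ◂ p} {first} p∼q = contradiction (∼-sym (∷-∼⁻ p∼q)) (zeros≁word p)
  word-∼-injective {p = c ◂ p} {d ◂ q} p∼q@(π , eq)
    with refl ← word-∼-injective {p = p} {q} (∷-∼⁻ p∼q) =
    cong (_◂ p) (trans (sym (word-rigid p π (∷-injectiveʳ eq) c)) (∷-injectiveˡ eq))

  ∷-zeros : ∀ {k} c → c ∷ zeros k ∼ zeros (suc k) ⊎ c ∷ zeros k ∼ word first
  ∷-zeros     0F = inj₁ ∼-refl
  ∷-zeros     1F = inj₂ ∼-refl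
  ∷-zeros {k} 2F = inj₂ (transpose 1F 2F ,
    cong (1F ∷_) (map-replicate (transpose 1F 2F ⟨$⟩ʳ_) 0F (suc k)))

  -- The tail is normalized first and its permutation is applied to the head. If the tail is
  -- constant, 1F and 2F can still be exchanged.
  zeros-or-word : ∀ {k} (t : Vec Color (suc k)) → t ∼ zeros k ⊎ ∃ λ (p : Pattern k) → t ∼ word p
  zeros-or-word (c ∷ []) = inj₁ (transpose c 0F , cong Vec.[_]
    (from-yes (all? λ (c : Color) → (transpose c 0F ⟨$⟩ʳ c) ≟ 0F) c))
  zeros-or-word (c ∷ t@(_ ∷ _)) with zeros-or-word t
  ... | inj₂ (p , π , eq) = inj₂ ((π ⟨$⟩ʳ c) ◂ p , π , cong ((π ⟨$⟩ʳ c) ∷_) eq)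
  ... | inj₁ (π , eq)     =
    Sum.map (∼-trans ∼zeros) (λ ∼first → first , ∼-trans ∼zeros ∼first) (∷-zeros (π ⟨$⟩ʳ c))
    where
    ∼zeros : c ∷ t ∼ (π ⟨$⟩ʳ c) ∷ zeros _
    ∼zeros = π , cong ((π ⟨$⟩ʳ c) ∷_) eq

  patterns : ∀ k → List (Pattern k)
  patterns zero    = []
  patterns (suc k) = first ∷ cartesianProductWith _◂_ (allFin 3) (patterns k)

  ∈-patterns : ∀ {k} (p : Pattern k) → p Propositional.∈ patterns k
  ∈-patterns first   = here refl
  ∈-patterns (c ◂ p) = there (∈-cartesianProductWith⁺ _◂_ (∈-allFin c) (∈-patterns p))

  patterns-unique : ∀ k → Propositional.Unique (patterns k)
  patterns-unique zero    = []
  patterns-unique (suc k) =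
    All.tabulate (λ { p∈ refl → first∉ p∈ }) ∷
    Propositional.cartesianProductWith⁺ _◂_ (λ { refl → refl , refl })
      (Propositional.allFin⁺ 3) (patterns-unique k)
    where
    first∉ : first Propositional.∉ cartesianProductWith _◂_ (allFin 3) (patterns k)
    first∉ first∈
      with _ , _ , _ , _ , () ← ∈-cartesianProductWith⁻ _◂_ (allFin 3) (patterns k) first∈

  -- The number of patterns obeys a(k + 1) = 1 + 3 a(k) with a(0) = 0, so it is (3 ^ k - 1) / 2,
  -- stated here without division.
  length-patterns : ∀ k → 2 * length (patterns k) + 1 ≡ 3 ^ k
  length-patterns zero    = refl
  length-patterns (suc k) = begin
    2 * suc (length (cartesianProductWith _◂_ (allFin 3) (patterns k))) + 1
      ≡⟨ cong (λ n → 2 * suc n + 1) (length-cartesianProductWith _◂_ (allFin 3) (patterns k)) ⟩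
    2 * suc (3 * length (patterns k)) + 1  ≡⟨ arith (length (patterns k)) ⟩
    3 * (2 * length (patterns k) + 1)      ≡⟨ cong (3 *_) (length-patterns k) ⟩
    3 * 3 ^ k                              ∎
    where
    open ≡-Reasoning
    arith : ∀ n → 2 * suc (3 * n) + 1 ≡ 3 * (2 * n + 1)
    arith = solve-∀

  representatives : ∀ k → List (Vec Color (suc k))
  representatives k = zeros k ∷ List.map word (patterns k)

  representatives-transversal : ∀ k → IsTransversal (words (suc k)) (λ _ → ⊤) (representatives k)
  representatives-transversal k = record
    { sound  = All.universal _ _
    ; unique = All.map⁺ (All.universal zeros≁word (patterns k))
             ∷ Unique.map⁺ (setoid _) (words (suc k)) word-∼-injective (patterns-unique k)
    ; cover  = λ {t} _ → case zeros-or-word t of λ where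
        (inj₁ ∼zeros)      → here ∼zeros
        (inj₂ (p , ∼word)) → there (Any.map (λ { refl → ∼word }) (∈-map⁺ word (∈-patterns p)))
    }

  -- Classes of balanced words and their recurrence.

  balancedReps unbalancedReps : ∀ k → List (Vec Color (suc k))
  balancedReps   k = filter balanced? (representatives k)
  unbalancedReps k = filter (¬? ∘ balanced?) (representatives k)

  balancedReps-transversal : ∀ k → IsTransversal (words (suc k)) Balanced (balancedReps k)
  balancedReps-transversal k =
    transversal-filter _ balanced? balanced-resp-∼ _ (representatives-transversal k)

  unbalancedReps-transversal : ∀ k → IsTransversal (words (suc k)) (¬_ ∘ Balanced)
                                             (unbalancedReps k)
  unbalancedReps-transversal k =
    transversal-filter _ (¬? ∘ balanced?)
      (λ s∼t ¬bal bal → ¬bal (balanced-resp-∼ (∼-sym s∼t) bal)) _ (representatives-transversal k)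

  -- 0F is a junk value, taken when t is already balanced.
  balance : ∀ {n} → Vec Color n → Vec Color (suc n)
  balance t = fromMaybe 0F (total t) ∷ t

  balance-balanced : ∀ {n} {t : Vec Color n} → ¬ Balanced t → Balanced (balance t)
  balance-balanced {t = t} ¬bal with total t
  ... | nothing = contradiction refl ¬bal
  ... | just c  = ⊕-self c

  balanced⇒balance : ∀ {n} c {t : Vec Color n} → Balanced (c ∷ t) → balance t ≡ c ∷ t
  balanced⇒balance c {t} bal = cong (λ x → fromMaybe 0F x ∷ t) (⊕-nothing⁻ c (total t) bal)

  balanced-∷⇒¬balanced : ∀ {n} c {t : Vec Color n} → Balanced (c ∷ t) → ¬ Balanced t
  balanced-∷⇒¬balanced c {t} bal bal′ with () ← trans (sym (⊕-nothing⁻ c (total t) bal)) bal′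

  -- Deleting the head inverts `balance`, as the head of a balanced word is the sum of its tail.
  balance-transversal : ∀ {n} {xs : List (Vec Color n)} →
                        IsTransversal (words n) (¬_ ∘ Balanced) xs →
                        IsTransversal (words (suc n)) Balanced (List.map balance xs)
  balance-transversal {n} tr = record
    { sound  = All.map⁺ (All.map (λ {t} → balance-balanced {t = t}) sound)
    ; unique = Unique.map⁺ (words n) (words (suc n)) ∷-∼⁻ unique
    ; cover  = λ { {c ∷ t} bal →
        Any.map⁺ (Any.map (extend c bal) (cover (balanced-∷⇒¬balanced c {t} bal))) }
    }
    where
    open IsTransversal tr
    extend : ∀ c {t u} → Balanced (c ∷ t) → t ∼ u → c ∷ t ∼ balance u
    -- The permuted word is still balanced, so its head is the letter that `balance` puts before
    -- `u`.
    extend c {t} bal (π , refl) = π , sym (balanced⇒balance (π ⟨$⟩ʳ c) {u}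
      (balanced-resp-∼ {s = c ∷ t} {(π ⟨$⟩ʳ c) ∷ u} (π , refl) bal))
      where u = Vec.map (π ⟨$⟩ʳ_) t

  -- Balanced classes of length k + 2 match unbalanced ones of length k + 1; together with the
  -- balanced ones these are all classes of length k + 1.
  length-balancedReps : ∀ k → length (balancedReps (suc k)) + length (balancedReps k) ≡
                        suc (length (patterns k))
  length-balancedReps k = begin
    length (balancedReps (suc k)) + length (balancedReps k)
      ≡⟨ cong (_+ length (balancedReps k)) (trans
           (transversal-length (words (2 + k)) (balancedReps-transversal (suc k))
                                               (balance-transversal (unbalancedReps-transversal k)))
           (length-map balance (unbalancedReps k))) ⟩
    length (unbalancedReps k) + length (balancedReps k)
      ≡⟨ length-filter-¬? balanced? (representatives k) ⟩
    length (representatives k)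
      ≡⟨ cong suc (length-map word (patterns k)) ⟩
    suc (length (patterns k)) ∎
    where open ≡-Reasoning

  -- Completeness makes balanced words states, and the Parity Lemma gives the converse.
  states-hasClasses : ∀ {k} (M : Multipole (suc k)) → ColorComplete M →
                      HasClasses (states M) (length (balancedReps k))
  states-hasClasses {k} M complete = transversal⇒hasClasses (words (suc k))
    (transversal-resp _ (λ {t} bal → complete t (balanced⇒admissible {t = t} bal))
                        (λ {t} st → admissible⇒balanced {t = t} (ParityLemma.state⇒admissible M st))
                        (balancedReps-transversal k))

open import Data.Integer.Base using (ℤ; +_; -1ℤ; _+_; _-_; _*_; _^_)
open import Data.Integer.Properties using (pos-*; *-identityʳ)
open import Data.Integer.Tactic.RingSolver using (solve-∀)
open import Data.Nat.Base as ℕ using (ℕ; zero; suc; _≤_; _∸_)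
open import Data.Rational.Base using (_/_)
open import Data.Rational.Properties using (fromℚᵘ-cong)
open import Data.Rational.Unnormalised.Base using (mkℚᵘ; *≡*)
open Counting
  using (patterns; length-patterns; balancedReps; length-balancedReps; states-hasClasses)

-- Solving the recurrence over the integers.

pos-^ : ∀ n k → + (n ℕ.^ k) ≡ (+ n) ^ k
pos-^ n zero    = refl
pos-^ n (suc k) = trans (pos-* n (n ℕ.^ k)) (cong (+ n *_) (pos-^ n k))

8*length-balancedReps : ∀ k → + length (balancedReps k) * + 8 ≡ (+ 3) ^ k + + 2 + -1ℤ ^ suc k * + 3
-- No word of length 1 is balanced, and 1 + 2 - 3 = 0.
8*length-balancedReps zero    = refl
8*length-balancedReps (suc k) = begin
  N′ * + 8
    ≡⟨ split N N′ ⟩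
  (N′ + N) * + 8 - N * + 8
    ≡⟨ cong₂ (λ x y → x * + 8 - y) (cong +_ (length-balancedReps k)) (8*length-balancedReps k) ⟩
  (+ 1 + Q) * + 8 - (P + + 2 + S * + 3)
    ≡⟨ cong (λ p → (+ 1 + Q) * + 8 - (p + + 2 + S * + 3)) P≡2Q+1 ⟩
  (+ 1 + Q) * + 8 - ((+ 2 * Q + + 1) + + 2 + S * + 3)
    ≡⟨ arith Q S ⟩
  + 3 * (+ 2 * Q + + 1) + + 2 + -1ℤ * S * + 3
    ≡⟨ cong (λ p → + 3 * p + + 2 + -1ℤ * S * + 3) P≡2Q+1 ⟨
  + 3 * P + + 2 + -1ℤ * S * + 3
    ∎
  where
  open ≡-Reasoning
  N N′ P Q S : ℤ
  N  = + length (balancedReps k)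
  N′ = + length (balancedReps (suc k))
  P  = (+ 3) ^ k
  Q  = + length (patterns k)
  S  = -1ℤ ^ suc k

  P≡2Q+1 : P ≡ + 2 * Q + + 1
  P≡2Q+1 = begin
    P                                     ≡⟨ pos-^ 3 k ⟨
    + (3 ℕ.^ k)                           ≡⟨ cong +_ (length-patterns k) ⟨
    + (2 ℕ.* length (patterns k)) + + 1   ≡⟨ cong (_+ + 1) (pos-* 2 (length (patterns k))) ⟩
    + 2 * Q + + 1                         ∎

  split : ∀ x y → y * + 8 ≡ (y + x) * + 8 - x * + 8
  split = solve-∀

  arith : ∀ q s → (+ 1 + q) * + 8 - ((+ 2 * q + + 1) + + 2 + s * + 3) ≡
                  + 3 * (+ 2 * q + + 1) + + 2 + -1ℤ * s * + 3
  arith = solve-∀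

i*8≡j⇒i/1≡j/8 : ∀ i j → i * + 8 ≡ j → i / 1 ≡ j / 8
-- Unnormalised fractions store the denominator minus one: 0 and 7 stand for 1 and 8.
i*8≡j⇒i/1≡j/8 i j eq = fromℚᵘ-cong {mkℚᵘ i 0} {mkℚᵘ j 7} (*≡* (trans eq (sym (*-identityʳ j))))

lemma3p1 : ∀ (m : ℕ) → 1 ≤ m → (M : Multipole m) → ColorComplete M →
    ∃ λ (N : ℕ) → HasClasses (states M) N ×
    (+ N) / 1 ≡ ((+ 3) ^ (m ∸ 1) + + 2 + -1ℤ ^ m * + 3) / 8
lemma3p1 (suc k) _ M complete =
  length (balancedReps k) ,
  states-hasClasses M complete ,
  i*8≡j⇒i/1≡j/8 (+ length (balancedReps k)) _ (8*length-balancedReps k)
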